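{- Let $\mathcal A$ be a model of cardinality $\omega_1$. If there is a model $\mathcal B$ of cardinality $>\omega_1$ such that $\mathcal A\equiv_{\omega_1}\mathcal B$, then $\mathcal A$ has exactly $2^{\omega_1}$ automorphisms.
   Context: Models are structures for a vocabulary of finitary relation and function symbols. A partial isomorphism between $\mathcal A$ and $\mathcal B$ is a partial map from the universe of $\mathcal A$ to that of $\mathcal B$ which preserves and reflects the truth of atomic formulas (including equalities). The Ehrenfeucht-Fraïssé game $G(\mathcal A,\mathcal B)$ of length $\omega_1$ between two models of the same vocabulary: two players $\exists$ and $\forall$ extend a countable partial isomorphism $\pi$ between $\mathcal A$ and $\mathcal B$. At the start $\pi=\emptyset$; at limit stages $\pi$ is the union of the earlier ones. At each of the $\omega_1$ moves, $\forall$ chooses an element in either $\mathcal A$ or $\mathcal B$, and then $\exists$ chooses an element in the other model. If $a\in\mathcal A$ and $b\in\mathcal B$ are the two chosen elements, then $\exists$ loses immediately if $\pi\cup\{(a,b)\}$ is not a partial isomorphism; otherwise $\pi\cup\{(a,b)\}$ is the new value of $\pi$ and the game continues. $\exists$ wins if he can move $\omega_1$ times without losing. We write $\mathcal A\equiv_{\omega_1}\mathcal B$ if $\exists$ has a winning strategy in $G(\mathcal A,\mathcal B)$. -}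

module Defs where

open import Data.Bool.Base using (Bool)
open import Data.Fin.Base using (Fin)
open import Data.Nat.Base using (ℕ)
open import Data.Product.Base using (Σ; ∃; _×_; _,_; proj₁; proj₂)
open import Data.Sum.Base using (_⊎_; inj₁; inj₂)
open import Data.Vec.Base as Vec using (Vec; []; _∷_)
open import Function.Bundles using (_↔_; _↣_; _⇔_; Inverse)
open import Induction.WellFounded using (WellFounded)
open import Level using (Level; _⊔_; suc)
open import Relation.Binary.Bundles using (Setoid)
open import Relation.Binary.Core using (Rel; REL)
open import Relation.Binary.Construct.Union using (_∪_)
open import Relation.Binary.PropositionalEquality
  using (_≡_; refl; sym; trans; _→-setoid_)
open import Relation.Binary.Structures using (IsStrictTotalOrder)
open import Relation.Nullary.Negation using (¬_)

-- The ordinal ω₁, up to isomorphism: an uncountable well-order all of whose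
-- proper initial segments are countable.

record Omega₁ (w ℓ : Level) : Set (suc (w ⊔ ℓ)) where
  infix 4 _<_
  field
    Carrier            : Set w
    _<_                : Rel Carrier ℓ
    isStrictTotalOrder : IsStrictTotalOrder _≡_ _<_
    wellFounded        : WellFounded _<_
    segment-countable  : ∀ α → ∃ λ (f : Carrier → ℕ) →
                         ∀ {β γ} → β < α → γ < α → f β ≡ f γ → β ≡ γ
    uncountable        : ¬ (Carrier ↣ ℕ)

record Vocabulary (v : Level) : Set (suc v) where
  field
    FunSym   : Set v
    RelSym   : Set v
    funArity : FunSym → ℕ
    relArity : RelSym → ℕ

record Model {v} (L : Vocabulary v) (a r : Level) : Set (v ⊔ suc (a ⊔ r)) where
  private module L = Vocabulary L
  field
    Universe : Set a
    fun      : (f : L.FunSym) → Vec Universe (L.funArity f) → Universe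
    rel      : (R : L.RelSym) → Vec Universe (L.relArity R) → Set r

module _ {v} (L : Vocabulary v) where
  private module L = Vocabulary L

  data Term (n : ℕ) : Set v where
    var : Fin n → Term n
    app : (f : L.FunSym) → Vec (Term n) (L.funArity f) → Term n

  infix 4 _≐_

  data Atomic (n : ℕ) : Set v where
    _≐_  : Term n → Term n → Atomic n
    atom : (R : L.RelSym) → Vec (Term n) (L.relArity R) → Atomic n

module _ {v a r} {L : Vocabulary v} (M : Model L a r) where
  private module M = Model M

  mutual
    eval : ∀ {n} → (Fin n → M.Universe) → Term L n → M.Universe
    eval ρ (var i)    = ρ i
    eval ρ (app f ts) = M.fun f (evals ρ ts)

    evals : ∀ {n k} → (Fin n → M.Universe) → Vec (Term L n) k → Vec M.Universe k
    evals ρ []       = []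
    evals ρ (t ∷ ts) = eval ρ t ∷ evals ρ ts

  -- A data type because the two cases live in different universes.
  data Satisfies {n} (ρ : Fin n → M.Universe) : Atomic L n → Set (v ⊔ a ⊔ r) where
    sat-≐    : ∀ {s t} → eval ρ s ≡ eval ρ t → Satisfies ρ (s ≐ t)
    sat-atom : ∀ {R ts} → M.rel R (evals ρ ts) → Satisfies ρ (atom R ts)

  record Automorphism : Set (v ⊔ a ⊔ r) where
    field
      bijection : M.Universe ↔ M.Universe
    open Inverse bijection public using (to; from)
    field
      preserves-fun : ∀ f xs → to (M.fun f xs) ≡ M.fun f (Vec.map to xs)
      preserves-rel : ∀ R xs → M.rel R xs ⇔ M.rel R (Vec.map to xs)

  Aut : Setoid (v ⊔ a ⊔ r) a
  Aut = record
    { Carrier       = Automorphism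
    ; _≈_           = λ g h → ∀ x → Automorphism.to g x ≡ Automorphism.to h x
    ; isEquivalence = record
      { refl  = λ _ → refl
      ; sym   = λ p x → sym (p x)
      ; trans = λ p q x → trans (p x) (q x)
      }
    }

module _ {v a b r s} {L : Vocabulary v} (A : Model L a r) (B : Model L b s) where
  private
    module A = Model A
    module B = Model B

  -- A partial map is represented by its graph.  Injectivity follows from
  -- reflecting the formula x ≐ y.
  record IsPartialIsomorphism {p} (π : REL A.Universe B.Universe p)
         : Set (v ⊔ a ⊔ b ⊔ r ⊔ s ⊔ p) where
    field
      functional : ∀ {x y y′} → π x y → π x y′ → y ≡ y′
      atomic     : ∀ {n} (φ : Atomic L n)
                   (ρ : Fin n → A.Universe) (σ : Fin n → B.Universe) →
                   (∀ i → π (ρ i) (σ i)) → Satisfies A ρ φ ⇔ Satisfies B σ φ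

  Move : Set (a ⊔ b)
  Move = A.Universe ⊎ B.Universe

  Reply : Move → Set (a ⊔ b)
  Reply (inj₁ _) = Level.Lift a B.Universe
  Reply (inj₂ _) = Level.Lift b A.Universe

  Round : Set (a ⊔ b)
  Round = Σ Move Reply

  chosen : Round → A.Universe × B.Universe
  chosen (inj₁ x , Level.lift y) = x , y
  chosen (inj₂ y , Level.lift x) = x , y

  module Game {w ℓ} (Ω : Omega₁ w ℓ) where
    open Omega₁ Ω using (_<_) renaming (Carrier to ω₁)

    -- In round α, ∃ sees all earlier rounds and the current move of ∀.
    Strategy : Set (a ⊔ b ⊔ w ⊔ ℓ)
    Strategy = ∀ α → (∀ β → β < α → Round) → (m : Move) → Reply m

    Play : Set (a ⊔ b ⊔ w)
    Play = ω₁ → Round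

    Follows : Strategy → Play → Set (a ⊔ b ⊔ w)
    Follows τ p = ∀ α → proj₂ (p α) ≡ τ α (λ β _ → p β) (proj₁ (p α))

    -- The value of π at the start of round α; at limits this is the union of
    -- the earlier values.
    position : Play → ω₁ → REL A.Universe B.Universe (a ⊔ b ⊔ w ⊔ ℓ)
    position p α x y = ∃ λ β → β < α × chosen (p β) ≡ (x , y)

    singleton : Round → REL A.Universe B.Universe (a ⊔ b)
    singleton m x y = chosen m ≡ (x , y)

    SurvivesRound : Play → ω₁ → Set (v ⊔ a ⊔ b ⊔ r ⊔ s ⊔ w ⊔ ℓ)
    SurvivesRound p α = IsPartialIsomorphism (position p α ∪ singleton (p α))

    -- Plays are always continued through all ω₁ rounds: what happens after ∃
    -- has lost is irrelevant, since one failed round already counts as a loss.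
    Winning : Strategy → Set (v ⊔ a ⊔ b ⊔ r ⊔ s ⊔ w ⊔ ℓ)
    Winning τ = ∀ p → Follows τ p → ∀ α → SurvivesRound p α

  EFEquivalent : ∀ {w ℓ} → Omega₁ w ℓ → Set (v ⊔ a ⊔ b ⊔ r ⊔ s ⊔ w ⊔ ℓ)
  EFEquivalent Ω = ∃ λ τ → Game.Winning Ω τ

module _ {w ℓ} (Ω : Omega₁ w ℓ) where
  open Omega₁ Ω using () renaming (Carrier to ω₁)

  HasCardinalityω₁ : ∀ {a} → Set a → Set (a ⊔ w)
  HasCardinalityω₁ X = X ↔ ω₁

  HasCardinality>ω₁ : ∀ {a} → Set a → Set (a ⊔ w)
  HasCardinality>ω₁ X = (ω₁ ↣ X) × ¬ (X ↣ ω₁)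

  HasCardinality2^ω₁ : ∀ {c e} → Setoid c e → Set (c ⊔ e ⊔ w)
  HasCardinality2^ω₁ S = Inverse S (ω₁ →-setoid Bool)

{-# OPTIONS --safe #-}
module Submission where

-- Play the game twice at once, both times with the winning strategy of ∃.  If
-- the resulting graphs P and Q are total on A and have the same range in B,
-- then x ↦ z with P x y and Q z y for some y is an automorphism of A.  Since B
-- does not inject into A, before any round there are y ≠ y′ to which P would
-- answer with the same x.  Letting P play y or y′ according to a bit while Q
-- plays y (answered by z) decides whether x ↦ z.  Each ordinal β gets stages
-- place (β , n) > β in which β is visited by both plays (n = 0), round β of
-- each play is copied to the other (n = 1), and the bit of β is used (n ≥ 2).
-- Excluded middle decides types, hence also makes all the choices.

open import Defs
open import Axiom.ExcludedMiddle using (ExcludedMiddle)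
open import Axiom.Extensionality.Propositional
  using (Extensionality; implicit-extensionality)
open import Data.Bool.Base using (Bool; true; false; if_then_else_)
open import Data.Empty using (⊥; ⊥-elim)
open import Data.Fin.Base using (Fin; zero; suc)
open import Data.Nat.Base as ℕ using (ℕ; zero; suc)
open import Data.Nat.Induction using (<-wellFounded)
open import Data.Nat.Properties using (even≢odd; *-cancelˡ-≡; suc-injective; <-cmp)
open import Data.Product.Base using (Σ; ∃; ∃₂; _×_; _,_; proj₁; proj₂)
open import Data.Product.Relation.Binary.Lex.Strict using (×-Lex; ×-wellFounded)
open import Data.Sum.Base using (_⊎_; inj₁; inj₂)
open import Data.Vec.Base as Vec using (Vec; []; _∷_; lookup; tabulate)
open import Data.Vec.Properties using (tabulate-∘; tabulate∘lookup)
open import Function.Base using (_∘_; case_of_; id)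
open import Function.Bundles
  using (Injection; Inverse; Equivalence; _↔_; _↣_; _⇔_; mk↣; mk⇔)
open import Function.Properties.Inverse using (Inverse⇒Injection)
open import Induction.WellFounded using (WellFounded; WfRec; module All; module FixPoint)
open import Level using (Level; _⊔_; lower)
open import Relation.Binary.Bundles using (Setoid)
open import Relation.Binary.Core using (Rel; REL)
open import Relation.Binary.Definitions using (tri<; tri≈; tri>)
open import Relation.Binary.PropositionalEquality
  using (_≡_; _≢_; refl; sym; trans; cong; subst)
open import Relation.Binary.Structures using (IsStrictTotalOrder)
open import Relation.Nullary using (¬_; yes; no)
open import Relation.Nullary.Decidable using (does; decidable-stable; dec-true)

-- Coding pairs of naturals: `pair m n` is 2^m (2n + 1) - 1.

-- Opaque, so that the arguments of pair can be read off a type by unification.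
opaque
  pair : ℕ → ℕ → ℕ
  pair zero    n = 2 ℕ.* n
  pair (suc m) n = suc (2 ℕ.* pair m n)

  pair-injective : ∀ m m′ {n n′} → pair m n ≡ pair m′ n′ → m ≡ m′ × n ≡ n′
  pair-injective zero    zero              eq = refl , *-cancelˡ-≡ _ _ 2 eq
  pair-injective zero    (suc m′) {n} {n′} eq = ⊥-elim (even≢odd n (pair m′ n′) eq)
  pair-injective (suc m) zero     {n} {n′} eq = ⊥-elim (even≢odd n′ (pair m n) (sym eq))
  pair-injective (suc m) (suc m′)          eq
    with refl , n≡ ← pair-injective m m′ (*-cancelˡ-≡ _ _ 2 (suc-injective eq)) = refl , n≡

-- Bijections of setoids and the Cantor-Bernstein theorem.

module _ {c d e f r : Level} {S : Setoid c e} {T : Setoid d f} where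
  private
    module S = Setoid S
    module T = Setoid T

  -- A relation treats the two directions alike, and `total` and `surjective` already carry the
  -- witnesses that become `to` and `from`.
  graph⇒inverse : (R : REL S.Carrier T.Carrier r) →
    (∀ x → ∃ λ y → R x y) → (∀ y → ∃ λ x → R x y) →
    (∀ {x x′ y y′} → x S.≈ x′ → R x y → R x′ y′ → y T.≈ y′) →
    (∀ {x x′ y y′} → y T.≈ y′ → R x y → R x′ y′ → x S.≈ x′) →
    Inverse S T
  graph⇒inverse R total surjective functional injective = record
    { to        = λ x → proj₁ (total x)
    ; from      = λ y → proj₁ (surjective y)
    ; to-cong   = λ x≈ → functional x≈ (proj₂ (total _)) (proj₂ (total _))
    ; from-cong = λ y≈ → injective y≈ (proj₂ (surjective _)) (proj₂ (surjective _))
    ; inverse   = (λ eq → functional eq (proj₂ (total _)) (proj₂ (surjective _)))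
                , (λ eq → injective eq (proj₂ (surjective _)) (proj₂ (total _)))
    }

module CantorBernstein (em : ∀ {p} → ExcludedMiddle p)
  {c d e f} {S : Setoid c e} {T : Setoid d f}
  (F : Injection S T) (G : Injection T S) where
  private
    module S = Setoid S
    module T = Setoid T
    module F = Injection F
    module G = Injection G

  -- The union of the images of the complement of the range of `G` under the iterates of `G` after
  -- `F`. On it the bijection is `F`, off it the inverse of `G`.
  data FromS (x : S.Carrier) : Set (c ⊔ d ⊔ e) where
    base : ¬ (∃ λ y → G.to y S.≈ x) → FromS x
    step : ∀ {x′} → FromS x′ → G.to (F.to x′) S.≈ x → FromS x

  FromS-resp : ∀ {x x′} → x S.≈ x′ → FromS x → FromS x′
  FromS-resp x≈ (base none)  = base λ (y , eq) → none (y , S.trans eq (S.sym x≈))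
  FromS-resp x≈ (step o eq) = step o (S.trans eq x≈)

  Matched : REL S.Carrier T.Carrier (c ⊔ d ⊔ e ⊔ f)
  Matched x y = (FromS x × F.to x T.≈ y) ⊎ (¬ FromS x × G.to y S.≈ x)

  cantorBernstein : Inverse S T
  cantorBernstein = graph⇒inverse Matched total surjective functional injective
    where
    total : ∀ x → ∃ λ y → Matched x y
    total x with em {P = FromS x}
    ... | yes o = F.to x , inj₁ (o , T.refl)
    ... | no ¬o with em {P = ∃ λ y → G.to y S.≈ x}
    ...   | yes (y , eq) = y , inj₂ (¬o , eq)
    ...   | no none      = ⊥-elim (¬o (base none))

    surjective : ∀ y → ∃ λ x → Matched x y
    surjective y with em {P = FromS (G.to y)}
    ... | no ¬o              = G.to y , inj₂ (¬o , S.refl)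
    ... | yes (base none)    = ⊥-elim (none (y , S.refl))
    ... | yes (step o eq)    = _ , inj₁ (o , G.injective eq)

    functional : ∀ {x x′ y y′} → x S.≈ x′ → Matched x y → Matched x′ y′ → y T.≈ y′
    functional x≈ (inj₁ (_ , p)) (inj₁ (_ , q)) = T.trans (T.sym p) (T.trans (F.cong x≈) q)
    functional x≈ (inj₁ (o , _)) (inj₂ (¬o , _)) = ⊥-elim (¬o (FromS-resp x≈ o))
    functional x≈ (inj₂ (¬o , _)) (inj₁ (o , _)) = ⊥-elim (¬o (FromS-resp (S.sym x≈) o))
    functional x≈ (inj₂ (_ , p)) (inj₂ (_ , q)) =
      G.injective (S.trans p (S.trans x≈ (S.sym q)))

    injective : ∀ {x x′ y y′} → y T.≈ y′ → Matched x y → Matched x′ y′ → x S.≈ x′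
    injective y≈ (inj₁ (_ , p)) (inj₁ (_ , q)) = F.injective (T.trans p (T.trans y≈ (T.sym q)))
    injective y≈ (inj₁ (o , p)) (inj₂ (¬o , q)) =
      ⊥-elim (¬o (step o (S.trans (G.cong (T.trans p y≈)) q)))
    injective y≈ (inj₂ (¬o , p)) (inj₁ (o , q)) =
      ⊥-elim (¬o (step o (S.trans (G.cong (T.trans q (T.sym y≈))) p)))
    injective y≈ (inj₂ (_ , p)) (inj₂ (_ , q)) = S.trans (S.sym p) (S.trans (G.cong y≈) q)

-- Combinatorics of ω₁: countable segments, stages and codes.

module Ordinals (em : ∀ {p} → ExcludedMiddle p) (ext : ∀ {p q} → Extensionality p q)
  {w ℓ} (Ω : Omega₁ w ℓ) where
  open Omega₁ Ω renaming (Carrier to ω₁)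
  open IsStrictTotalOrder isStrictTotalOrder using (compare) renaming (trans to <-trans)

  infix 4 _≤_ _≺_

  _≤_ : Rel ω₁ (w ⊔ ℓ)
  β ≤ α = β < α ⊎ β ≡ α

  ≤-trans : ∀ {α β γ} → α ≤ β → β ≤ γ → α ≤ γ
  ≤-trans (inj₁ p)    (inj₁ q)    = inj₁ (<-trans p q)
  ≤-trans (inj₁ p)    (inj₂ refl) = inj₁ p
  ≤-trans (inj₂ refl) q           = q

  ≮⇒≥ : ∀ {α β} → ¬ α < β → β ≤ α
  ≮⇒≥ {α} {β} α≮β with compare α β
  ... | tri< α<β _ _ = ⊥-elim (α≮β α<β)
  ... | tri≈ _ α≡β _ = inj₂ (sym α≡β)
  ... | tri> _ _ β<α = inj₁ β<α

  upperBound : ∀ α β → ∃ λ γ → α ≤ γ × β ≤ γ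
  upperBound α β with compare α β
  ... | tri< α<β _ _ = β , inj₁ α<β , inj₂ refl
  ... | tri≈ _ α≡β _ = β , inj₂ α≡β , inj₂ refl
  ... | tri> _ _ β<α = α , inj₂ refl , inj₁ β<α

  inhabited : ω₁
  inhabited with em {P = ω₁}
  ... | yes α = α
  ... | no ∄α = ⊥-elim (uncountable (mk↣ {to = ⊥-elim ∘ ∄α} λ {α} → ⊥-elim (∄α α)))

  finite-bound : ∀ n (f : Fin n → ω₁) → ∃ λ γ → ∀ i → f i ≤ γ
  finite-bound zero    f = inhabited , λ ()
  finite-bound (suc n) f with finite-bound n (f ∘ suc)
  ... | γ , f≤γ with upperBound (f zero) γ
  ...   | δ , f0≤δ , γ≤δ = δ , λ { zero → f0≤δ ; (suc i) → ≤-trans (f≤γ i) γ≤δ }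

  -- `segment-countable` covers only the ordinals strictly below γ; shifting by `suc` reserves 0 for
  -- γ itself. Above γ the value is a mere default.
  segmentCode : ω₁ → ω₁ → ℕ
  segmentCode γ α with compare α γ
  ... | tri< _ _ _ = suc (proj₁ (segment-countable γ) α)
  ... | tri≈ _ _ _ = 0
  ... | tri> _ _ _ = 0

  segmentCode-injective : ∀ γ {α β} → α ≤ γ → β ≤ γ →
    segmentCode γ α ≡ segmentCode γ β → α ≡ β
  segmentCode-injective γ {α} {β} α≤γ β≤γ eq with compare α γ | compare β γ
  segmentCode-injective γ α≤γ β≤γ eq | tri< α<γ _ _ | tri< β<γ _ _ =
    proj₂ (segment-countable γ) α<γ β<γ (suc-injective eq)
  segmentCode-injective γ α≤γ β≤γ eq | tri≈ _ α≡γ _ | tri≈ _ β≡γ _ = trans α≡γ (sym β≡γ)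
  segmentCode-injective γ (inj₁ α<γ) β≤γ eq | tri> α≮γ _ _ | _ = ⊥-elim (α≮γ α<γ)
  segmentCode-injective γ (inj₂ α≡γ) β≤γ eq | tri> _ α≢γ _ | _ = ⊥-elim (α≢γ α≡γ)
  segmentCode-injective γ α≤γ (inj₁ β<γ) eq | _ | tri> β≮γ _ _ = ⊥-elim (β≮γ β<γ)
  segmentCode-injective γ α≤γ (inj₂ β≡γ) eq | _ | tri> _ β≢γ _ = ⊥-elim (β≢γ β≡γ)

  _≺_ : Rel (ω₁ × ℕ) (w ⊔ ℓ)
  _≺_ = ×-Lex _≡_ _<_ ℕ._<_

  ≺-wellFounded : WellFounded _≺_
  ≺-wellFounded = ×-wellFounded wellFounded <-wellFounded

  ≺-connex : ∀ x y → x ≺ y ⊎ x ≡ y ⊎ y ≺ x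
  ≺-connex (α , m) (β , n) with compare α β
  ... | tri< α<β _ _  = inj₁ (inj₁ α<β)
  ... | tri> _ _ β<α  = inj₂ (inj₂ (inj₁ β<α))
  ... | tri≈ _ refl _ with <-cmp m n
  ...   | tri< m<n _ _  = inj₁ (inj₂ (refl , m<n))
  ...   | tri≈ _ refl _ = inj₂ (inj₁ refl)
  ...   | tri> _ _ n<m  = inj₂ (inj₂ (inj₂ (refl , n<m)))

  ≺⇒≤ : ∀ {x y} → x ≺ y → proj₁ x ≤ proj₁ y
  ≺⇒≤ (inj₁ α<β)       = inj₁ α<β
  ≺⇒≤ (inj₂ (α≡β , _)) = inj₂ α≡β

  Values : ω₁ × ℕ → Set (w ⊔ ℓ)
  Values = WfRec _≺_ λ _ → ω₁

  -- Avoiding the earlier values makes `place` injective. Lying strictly above the first component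
  -- ensures that round β is over when a stage of β arrives.
  Fresh : ∀ x → Values x → ω₁ → Set (w ⊔ ℓ)
  Fresh x h α = proj₁ x < α × (∀ {y} (y≺x : y ≺ x) → h y≺x ≢ α)

  pick : ∀ x → Values x → ω₁
  pick x h with em {P = ∃ (Fresh x h)}
  ... | yes (α , _) = α
  -- A default, never reached when the earlier values come from a function on all pairs.
  ... | no _        = proj₁ x

  -- Only countably many ordinals are excluded.
  pick-fresh : ∀ x (h : ω₁ × ℕ → ω₁) → Fresh x (λ {y} _ → h y) (pick x λ {y} _ → h y)
  pick-fresh x h with em {P = ∃ (Fresh x (λ {y} _ → h y))}
  ... | yes (_ , fresh) = fresh
  ... | no none         = ⊥-elim (uncountable (mk↣ {to = index ∘ excluded}
                                  λ {α} {β} → index-injective (excluded α) (excluded β)))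
    where
    Excluded : ω₁ → Set (w ⊔ ℓ)
    Excluded α = α ≤ proj₁ x ⊎ ∃ λ y → y ≺ x × h y ≡ α

    excluded : ∀ α → Excluded α
    excluded α with em {P = Excluded α}
    ... | yes out = out
    ... | no ¬out = ⊥-elim (none (α , decidable-stable em (λ α≯ → ¬out (inj₁ (≮⇒≥ α≯)))
                                    , λ {y} y≺x eq → ¬out (inj₂ (y , y≺x , eq))))

    index : ∀ {α} → Excluded α → ℕ
    -- The tags 0 and 1 separate the two ways of being excluded. A pair `y ≺ x` has first component
    -- at most `proj₁ x`, so codes for a single closed segment suffice.
    index {α} (inj₁ _)             = pair 0 (segmentCode (proj₁ x) α)
    index     (inj₂ ((β , m) , _)) = pair 1 (pair m (segmentCode (proj₁ x) β))

    index-injective : ∀ {α β} (u : Excluded α) (v : Excluded β) → index u ≡ index v → α ≡ β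
    index-injective (inj₁ α≤) (inj₁ β≤) eq =
      segmentCode-injective (proj₁ x) α≤ β≤ (proj₂ (pair-injective 0 0 eq))
    index-injective (inj₁ _) (inj₂ _) eq with () ← proj₁ (pair-injective 0 1 eq)
    index-injective (inj₂ _) (inj₁ _) eq with () ← proj₁ (pair-injective 1 0 eq)
    index-injective (inj₂ ((_ , m) , y≺x , refl)) (inj₂ ((_ , n) , z≺x , refl)) eq
      with refl , eq′ ← pair-injective m n (proj₂ (pair-injective 1 1 eq))
      with refl ← segmentCode-injective (proj₁ x) (≺⇒≤ y≺x) (≺⇒≤ z≺x) eq′ = refl

  opaque
    place : ω₁ × ℕ → ω₁
    place = All.wfRec ≺-wellFounded _ (λ _ → ω₁) pick

    place-fresh : ∀ x → Fresh x (λ {y} _ → place y) (place x)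
    place-fresh x = subst (Fresh x (λ {y} _ → place y)) (sym unfolded) (pick-fresh x place)
      where
      unfolded : place x ≡ pick x (λ {y} _ → place y)
      unfolded = FixPoint.unfold-wfRec ≺-wellFounded (λ _ → ω₁) pick
        λ x eq → cong (λ (h : Values x) → pick x h)
                      (implicit-extensionality ext (ext λ y≺x → eq y≺x))

  -- Of two distinct pairs one comes later in `≺`, and its value was chosen to avoid that of the
  -- other.
  place-injective : ∀ {x y} → place x ≡ place y → x ≡ y
  place-injective {x} {y} eq with ≺-connex x y
  ... | inj₁ x≺y        = ⊥-elim (proj₂ (place-fresh y) x≺y eq)
  ... | inj₂ (inj₁ x≡y) = x≡y
  ... | inj₂ (inj₂ y≺x) = ⊥-elim (proj₂ (place-fresh x) y≺x (sym eq))

  opaque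
    unplace : ω₁ → ω₁ × ℕ
    unplace α with em {P = ∃ λ x → place x ≡ α}
    ... | yes (x , _) = x
    -- An ordinal that is no stage counts as an additional visiting round, which is harmless.
    ... | no _        = α , 0

    unplace-place : ∀ x → unplace (place x) ≡ x
    unplace-place x with em {P = ∃ λ y → place y ≡ place x}
    ... | yes (y , eq) = place-injective eq
    ... | no none      = ⊥-elim (none (x , refl))

  -- Below a common bound γ both ordinals are determined by natural numbers, so the pair becomes an
  -- element of ω₁ × ℕ, which `place` injects into ω₁.
  pairing : ω₁ → ω₁ → ω₁
  pairing α β with upperBound α β
  ... | γ , _ = place (γ , pair (segmentCode γ α) (segmentCode γ β))

  pairing-injective : ∀ α β α′ β′ → pairing α β ≡ pairing α′ β′ → α ≡ α′ × β ≡ β′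
  pairing-injective α β α′ β′ eq with upperBound α β | upperBound α′ β′
  ... | γ , α≤ , β≤ | γ′ , α′≤ , β′≤ with place-injective eq
  ...   | eq′ with refl ← cong proj₁ eq′
              with p , q ← pair-injective (segmentCode γ α) (segmentCode γ α′) (cong proj₂ eq′)
    = segmentCode-injective γ α≤ α′≤ p , segmentCode-injective γ β≤ β′≤ q

  graphCode : (ω₁ → ω₁) → ω₁ → Bool
  graphCode g α = does (em {P = ∃ λ β → pairing β (g β) ≡ α})

  -- A function is determined by its graph, here coded as a subset of ω₁. This embeds the functions
  -- from ω₁ to ω₁ into 2^ω₁ and gives the upper bound.
  graphCode-injective : ∀ {g h} → (∀ α → graphCode g α ≡ graphCode h α) → ∀ β → g β ≡ h β
  graphCode-injective {g} {h} eq β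
    with em {P = ∃ λ γ → pairing γ (h γ) ≡ pairing β (g β)}
       | trans (sym (eq (pairing β (g β)))) (dec-true em (β , refl))
  ... | yes (γ , same) | _ with refl , hβ≡gβ ← pairing-injective γ (h γ) β (g β) same = sym hβ≡gβ

-- Partial isomorphisms: composition, and passage to automorphisms.

module _ {v a r} {L : Vocabulary v} (M : Model L a r) where
  private module M = Model M

  evals-variables : ∀ {n k} (ρ : Fin n → M.Universe) (κ : Fin k → Fin n) →
    evals M ρ (tabulate (var ∘ κ)) ≡ tabulate (ρ ∘ κ)
  evals-variables {k = zero}  ρ κ = refl
  evals-variables {k = suc _} ρ κ = cong (ρ (κ zero) ∷_) (evals-variables ρ (κ ∘ suc))

module _ {v a b r s p} {L : Vocabulary v} {A : Model L a r} {B : Model L b s}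
  {π : REL (Model.Universe A) (Model.Universe B) p} (iso : IsPartialIsomorphism A B π) where
  open IsPartialIsomorphism iso

  partialIso-injective : ∀ {x x′ y} → π x y → π x′ y → x ≡ x′
  partialIso-injective {x} {x′} {y} xy x′y
    with sat-≐ eq ← Equivalence.from
           (atomic (var zero ≐ var (suc zero)) (lookup (x ∷ x′ ∷ [])) (λ _ → y)
                   λ { zero → xy ; (suc zero) → x′y })
           (sat-≐ refl) = eq

infixl 8 _⨾°_
_⨾°_ : ∀ {a b c p q} {X : Set a} {Y : Set b} {Z : Set c} →
  REL X Y p → REL Z Y q → REL X Z (b ⊔ p ⊔ q)
(π ⨾° θ) x z = ∃ λ y → π x y × θ z y

module _ {v a b c r s t p q} {L : Vocabulary v}
  {A : Model L a r} {B : Model L b s} {C : Model L c t}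
  {π : REL (Model.Universe A) (Model.Universe B) p}
  {θ : REL (Model.Universe C) (Model.Universe B) q} where

  -- Corresponding tuples in `A` and `C` share a tuple in `B`, through which the truth of an atomic
  -- formula passes. Functionality comes from the injectivity of `θ`.
  partialIso-⨾° : IsPartialIsomorphism A B π → IsPartialIsomorphism C B θ →
    IsPartialIsomorphism A C (π ⨾° θ)
  partialIso-⨾° I J = record
    { functional = λ { (_ , xy , zy) (_ , xy′ , z′y′) →
        partialIso-injective J zy (subst (θ _) (I.functional xy′ xy) z′y′) }
    ; atomic = λ φ ρ σ rel →
        let I⇔ = I.atomic φ ρ (proj₁ ∘ rel) (proj₁ ∘ proj₂ ∘ rel)
            J⇔ = J.atomic φ σ (proj₁ ∘ rel) (proj₂ ∘ proj₂ ∘ rel)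
        in mk⇔ (Equivalence.from J⇔ ∘ Equivalence.to I⇔)
               (Equivalence.from I⇔ ∘ Equivalence.to J⇔)
    }
    where
    module I = IsPartialIsomorphism I
    module J = IsPartialIsomorphism J

module _ {v a r p} {L : Vocabulary v} {A : Model L a r}
  {π : REL (Model.Universe A) (Model.Universe A) p} (iso : IsPartialIsomorphism A A π)
  (total : ∀ x → ∃ λ y → π x y) (surjective : ∀ y → ∃ λ x → π x y) where
  private module A = Model A
  open IsPartialIsomorphism iso

  partialIso⇒automorphism : Automorphism A
  partialIso⇒automorphism = record
    { bijection     = graph⇒inverse π total surjective
        (λ { refl → functional }) (λ { refl → partialIso-injective iso })
    ; preserves-fun = preserves-fun
    ; preserves-rel = preserves-rel
    }
    where
    image : A.Universe → A.Universe
    image = proj₁ ∘ total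

    tabulate-map : ∀ {n} (xs : Vec A.Universe n) →
      tabulate (image ∘ lookup xs) ≡ Vec.map image xs
    tabulate-map xs = trans (tabulate-∘ image (lookup xs)) (cong (Vec.map image) (tabulate∘lookup xs))

    preserves-fun : ∀ f xs → image (A.fun f xs) ≡ A.fun f (Vec.map image xs)
    preserves-fun f xs
      with sat-≐ eq ← Equivalence.to
             -- The formula x₀ = f(x₁, ..., xₖ), with the value of f at `xs` assigned to x₀:
             -- preserving it says that the image of the value is the value at the images.
             (atomic (var zero ≐ app f (tabulate (var ∘ suc)))
                     (lookup (A.fun f xs ∷ xs)) (image ∘ lookup (A.fun f xs ∷ xs)) λ _ → proj₂ (total _))
             (sat-≐ (cong (A.fun f) (sym (trans (evals-variables A _ suc) (tabulate∘lookup xs)))))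
      = trans eq (cong (A.fun f) (trans (evals-variables A _ suc) (tabulate-map xs)))

    preserves-rel : ∀ R xs → A.rel R xs ⇔ A.rel R (Vec.map image xs)
    preserves-rel R xs = mk⇔
      (λ Rxs → case Equivalence.to atom⇔ (sat-atom (subst (A.rel R) (sym source) Rxs)) of
        λ { (sat-atom Rys) → subst (A.rel R) target Rys })
      (λ Rys → case Equivalence.from atom⇔ (sat-atom (subst (A.rel R) (sym target) Rys)) of
        λ { (sat-atom Rxs) → subst (A.rel R) source Rxs })
      where
      source : evals A (lookup xs) (tabulate var) ≡ xs
      source = trans (evals-variables A _ id) (tabulate∘lookup xs)

      target : evals A (image ∘ lookup xs) (tabulate var) ≡ Vec.map image xs
      target = trans (evals-variables A _ id) (tabulate-map xs)

      atom⇔ = atomic (atom R (tabulate var)) (lookup xs) (image ∘ lookup xs) λ _ → proj₂ (total _)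

-- The two simultaneous plays steered by a bit sequence.

module Branches (em : ∀ {p} → ExcludedMiddle p) (ext : ∀ {p q} → Extensionality p q)
  {v a b r s w ℓ} (Ω : Omega₁ w ℓ) {L : Vocabulary v} (A : Model L a r) (B : Model L b s)
  (A↔ω₁ : Model.Universe A ↔ Omega₁.Carrier Ω)
  (B-large : ¬ (Model.Universe B ↣ Omega₁.Carrier Ω))
  (τ : Game.Strategy A B Ω) (winning : Game.Winning A B Ω τ) where

  open Omega₁ Ω renaming (Carrier to ω₁)
  open Ordinals em ext Ω
  open Game A B Ω
  private
    module A = Model A
    module B = Model B
    module E = Inverse A↔ω₁

  Graph : Play → REL A.Universe B.Universe (a ⊔ b ⊔ w)
  Graph p x y = ∃ λ α → chosen A B (p α) ≡ (x , y)

  visits : ∀ p α {x} → proj₁ (chosen A B (p α)) ≡ x → ∃ λ y → Graph p x y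
  visits p α refl = _ , α , refl

  meets : ∀ p α {y} → proj₂ (chosen A B (p α)) ≡ y → ∃ λ x → Graph p x y
  meets p α refl = _ , α , refl

  -- Each condition on a partial isomorphism involves finitely many pairs. Their rounds have a
  -- common bound γ, and surviving round γ yields the condition.
  graph-partialIso : ∀ p → Follows τ p → IsPartialIsomorphism A B (Graph p)
  graph-partialIso p follows = record { functional = functional ; atomic = atomic }
    where
    survives : ∀ γ → SurvivesRound p γ
    survives = winning p follows

    played : ∀ {x y γ} ((α , _) : Graph p x y) → α ≤ γ →
      position p γ x y ⊎ singleton (p γ) x y
    played (α , eq) (inj₁ α<γ)  = inj₁ (α , α<γ , eq)
    played (α , eq) (inj₂ refl) = inj₂ eq

    functional : ∀ {x y y′} → Graph p x y → Graph p x y′ → y ≡ y′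
    functional u@(α , _) u′@(α′ , _) with upperBound α α′
    ... | γ , α≤γ , α′≤γ =
      IsPartialIsomorphism.functional (survives γ) (played u α≤γ) (played u′ α′≤γ)

    atomic : ∀ {n} (φ : Atomic L n) ρ σ → (∀ i → Graph p (ρ i) (σ i)) →
      Satisfies A ρ φ ⇔ Satisfies B σ φ
    atomic φ ρ σ u with finite-bound _ (proj₁ ∘ u)
    ... | γ , ≤γ = IsPartialIsomorphism.atomic (survives γ) φ ρ σ λ i → played (u i) (≤γ i)

  History : ω₁ → Set (a ⊔ b ⊔ w ⊔ ℓ)
  History α = ∀ β → β < α → Round A B × Round A B

  left right : ∀ {α} → History α → ∀ β → β < α → Round A B
  left  h β β<α = proj₁ (h β β<α)
  right h β β<α = proj₂ (h β β<α)

  answer : ∀ α → History α → B.Universe → A.Universe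
  answer α h y = lower (τ α (left h) (inj₂ y))

  Collision : ∀ α → History α → Set (a ⊔ b)
  Collision α h = ∃₂ λ y y′ → y ≢ y′ × answer α h y ≡ answer α h y′

  -- Otherwise `answer α h` would inject `B` into `A`, hence into ω₁. The pair found depends only on
  -- α and the history, so bit sequences with the same past split on the same pair.
  collision : ∀ α h → Collision α h
  collision α h with em {P = Collision α h}
  ... | yes found = found
  ... | no none   = ⊥-elim (B-large (mk↣ {to = E.to ∘ answer α h} λ {y} {y′} eq →
    decidable-stable em λ y≢y′ →
      none (y , y′ , y≢y′ , Injection.injective (Inverse⇒Injection A↔ω₁) eq)))

  moves : Bool → ω₁ × ℕ → ∀ α → History α → Move A B × Move A B
  moves _ (β , 0) α h = inj₁ (E.from β) , inj₁ (E.from β)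
  moves _ (β , 1) α h with em {P = β < α}
  ... | yes β<α = inj₂ (proj₂ (chosen A B (right h β β<α)))
                , inj₂ (proj₂ (chosen A B (left h β β<α)))
  -- A default: at `place (β , 1)` freshness guarantees β < α.
  ... | no _    = inj₁ (E.from β) , inj₁ (E.from β)
  moves bit (_ , suc (suc _)) α h = let y , y′ , _ = collision α h in
    inj₂ (if bit then y else y′) , inj₂ y

  respond : ∀ α → History α → Move A B × Move A B → Round A B × Round A B
  respond α h (m , n) = (m , τ α (left h) m) , (n , τ α (right h) n)

  module _ (bits : ω₁ → Bool) where

    round : ∀ α → History α → Round A B × Round A B
    round α h = respond α h (moves (bits (proj₁ (unplace α))) (unplace α) α h)

    opaque
      plays : ω₁ → Round A B × Round A B
      plays = All.wfRec wellFounded _ _ λ α h → round α λ _ → h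

      plays-unfold : ∀ α → plays α ≡ round α (λ β _ → plays β)
      plays-unfold α = FixPoint.unfold-wfRec wellFounded _ _
        λ α eq → cong (round α) (ext λ _ → ext λ β<α → eq β<α)

    past : ∀ α → History α
    past α β _ = plays β

    P Q : Play
    P = proj₁ ∘ plays
    Q = proj₂ ∘ plays

    plays-place : ∀ x →
      let α = place x in plays α ≡ respond α (past α) (moves (bits (proj₁ x)) x α (past α))
    plays-place x = trans (plays-unfold α)
      (cong (λ z → respond α (past α) (moves (bits (proj₁ z)) z α (past α))) (unplace-place x))
      where α = place x

    P-iso : IsPartialIsomorphism A B (Graph P)
    P-iso = graph-partialIso P λ α →
      -- `respond` replies with `τ` by construction, so after unfolding the equation is `refl`.
      subst (λ z → proj₂ (proj₁ z) ≡ τ α (left (past α)) (proj₁ (proj₁ z))) (sym (plays-unfold α)) refl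

    Q-iso : IsPartialIsomorphism A B (Graph Q)
    Q-iso = graph-partialIso Q λ α →
      subst (λ z → proj₂ (proj₂ z) ≡ τ α (right (past α)) (proj₁ (proj₂ z))) (sym (plays-unfold α)) refl

    P-total : ∀ x → ∃ λ y → Graph P x y
    P-total x = visits P (place (E.to x , 0))
      (trans (cong (proj₁ ∘ chosen A B ∘ proj₁) (plays-place _)) (E.strictlyInverseʳ x))

    Q-total : ∀ x → ∃ λ y → Graph Q x y
    Q-total x = visits Q (place (E.to x , 0))
      (trans (cong (proj₁ ∘ chosen A B ∘ proj₂) (plays-place _)) (E.strictlyInverseʳ x))

    -- Makes the two plays have the same range in `B`, on which totality and surjectivity of `Link`
    -- rest.
    exchange : ∀ β → let α = place (β , 1) in
      proj₂ (chosen A B (P α)) ≡ proj₂ (chosen A B (Q β)) ×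
      proj₂ (chosen A B (Q α)) ≡ proj₂ (chosen A B (P β))
    exchange β =
      cong (proj₂ ∘ chosen A B ∘ proj₁) eq , cong (proj₂ ∘ chosen A B ∘ proj₂) eq
      where
      α = place (β , 1)
      eq : plays α ≡ respond α (past α)
             (inj₂ (proj₂ (chosen A B (Q β))) , inj₂ (proj₂ (chosen A B (P β))))
      eq = trans (plays-place (β , 1)) (cong (respond α (past α)) moves-eq)
        where
        moves-eq : moves (bits β) (β , 1) α (past α) ≡
          (inj₂ (proj₂ (chosen A B (Q β))) , inj₂ (proj₂ (chosen A B (P β))))
        moves-eq with em {P = β < α}
        ... | yes _   = refl
        ... | no β≮α = ⊥-elim (β≮α (proj₁ (place-fresh (β , 1))))

    range-P⊆Q : ∀ {x y} → Graph P x y → ∃ λ z → Graph Q z y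
    range-P⊆Q (β , eq) = meets Q (place (β , 1)) (trans (proj₂ (exchange β)) (cong proj₂ eq))

    range-Q⊆P : ∀ {x y} → Graph Q x y → ∃ λ z → Graph P z y
    range-Q⊆P (β , eq) = meets P (place (β , 1)) (trans (proj₁ (exchange β)) (cong proj₂ eq))

    Link : REL A.Universe A.Universe (a ⊔ b ⊔ w)
    Link = Graph P ⨾° Graph Q

    link-iso : IsPartialIsomorphism A A Link
    link-iso = partialIso-⨾° P-iso Q-iso

    link-total : ∀ x → ∃ λ z → Link x z
    link-total x = let y , xy = P-total x ; z , zy = range-P⊆Q xy in z , y , xy , zy

    link-surjective : ∀ z → ∃ λ x → Link x z
    link-surjective z = let y , zy = Q-total z ; x , xy = range-Q⊆P zy in x , y , xy , zy

    automorphism : Automorphism A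
    automorphism = partialIso⇒automorphism link-iso link-total link-surjective

    -- The history and the bit are variables so that the rounds of two bit sequences can be compared
    -- over one common past.
    round-split : ∀ {α β n} → unplace α ≡ (β , suc (suc n)) → ∀ h {bit} → past α ≡ h → bits β ≡ bit →
      plays α ≡ respond α h (moves bit (β , suc (suc n)) α h)
    round-split {α} {β} eq h refl refl = trans (plays-unfold α)
      (cong (λ x → respond α h (moves (bits (proj₁ x)) x α h)) eq)

  -- Different bit sequences give different automorphisms.

  module _ (bits bits′ : ω₁ → Bool)
    (same : ∀ x → Automorphism.to (automorphism bits) x ≡ Automorphism.to (automorphism bits′) x) where

    -- In this round the first sequence plays (x , y) and (z , y), so its automorphism sends x to z.
    -- The second plays (x , y′) and (z , y). If it also linked x to z through some y″,
    -- functionality of its two graphs would give y = y″ = y′.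
    no-clash : ∀ {α β n} → unplace α ≡ (β , suc (suc n)) → past bits α ≡ past bits′ α →
      bits β ≡ true → bits′ β ≡ false → ⊥
    no-clash {α} eq pasts is-true is-false =
      let h = past bits α
          y , y′ , y≢y′ , x≡x′ = collision α h
          x = answer α h y
          round₁ = round-split bits eq h refl is-true
          round₂ = round-split bits′ eq h (sym pasts) is-false
          to-x≡z = IsPartialIsomorphism.functional (link-iso bits) (proj₂ (link-total bits x))
            (y , (α , cong (chosen A B ∘ proj₁) round₁) , (α , cong (chosen A B ∘ proj₂) round₁))
          -- By `same` the second automorphism sends x to z as well; y″ is the element of `B`
          -- through which it does so.
          y″ , xy″ , zy″ = subst (Link bits′ x) (trans (sym (same x)) to-x≡z) (proj₂ (link-total bits′ x))
          xy′ = α , trans (cong (chosen A B ∘ proj₁) round₂) (cong (_, y′) (sym x≡x′))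
          zy = α , cong (chosen A B ∘ proj₂) round₂
      in y≢y′ (trans (IsPartialIsomorphism.functional (Q-iso bits′) zy zy″)
                     (IsPartialIsomorphism.functional (P-iso bits′) xy″ xy′))

  module _ (bits bits′ : ω₁ → Bool)
    (same : ∀ x → Automorphism.to (automorphism bits) x ≡ Automorphism.to (automorphism bits′) x) where

    split-bit : ∀ {α β n} → unplace α ≡ (β , suc (suc n)) → past bits α ≡ past bits′ α →
      bits β ≡ bits′ β
    split-bit {β = β} eq pasts with bits β in e | bits′ β in e′
    ... | true  | true  = refl
    ... | false | false = refl
    ... | true  | false = ⊥-elim (no-clash bits bits′ same eq pasts e e′)
    ... | false | true  = ⊥-elim (no-clash bits′ bits (sym ∘ same) eq (sym pasts) e′ e)

    moves-agree : ∀ {α} x → unplace α ≡ x → past bits α ≡ past bits′ α → ∀ h →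
      moves (bits (proj₁ x)) x α h ≡ moves (bits′ (proj₁ x)) x α h
    moves-agree (_ , 0)           _  _     _ = refl
    moves-agree (_ , 1)           _  _     _ = refl
    moves-agree x@(_ , suc (suc _)) eq pasts h = cong (λ bit → moves bit x _ h) (split-bit eq pasts)

    -- By induction: the bit sequences influence a round only through its past and, at a splitting
    -- stage, its bit. Equal pasts force that bit to agree, since the automorphisms do.
    plays-agree : ∀ α → plays bits α ≡ plays bits′ α
    plays-agree = All.wfRec wellFounded _ _ λ α earlier →
      let pasts = ext λ _ → ext λ β<α → earlier β<α
      in trans (plays-unfold bits α)
        (trans (cong (respond α (past bits α)) (moves-agree (unplace α) refl pasts (past bits α)))
        (trans (cong (round bits′ α) pasts) (sym (plays-unfold bits′ α))))

    automorphism-injective : ∀ β → bits β ≡ bits′ β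
    automorphism-injective β =
      -- The index 2 is the first splitting stage of β, and by now all pasts agree.
      split-bit (unplace-place (β , 2)) (ext λ γ → ext λ _ → plays-agree γ)

-- Counting the automorphisms by injections in both directions.

theorem1 : (∀ {p} → ExcludedMiddle p) →
    (∀ {p q} → Extensionality p q) →
    ∀ {v a b r s w ℓ} (Ω : Omega₁ w ℓ) (L : Vocabulary v) (A : Model L a r) →
    HasCardinalityω₁ Ω (Model.Universe A) →
    (Σ (Model L b s) λ B → HasCardinality>ω₁ Ω (Model.Universe B) × EFEquivalent A B Ω) →
    HasCardinality2^ω₁ Ω (Aut A)
theorem1 em ext Ω L A A↔ω₁ (B , (_ , B-large) , τ , winning) =
  CantorBernstein.cantorBernstein em
    -- At most 2^ω₁: an automorphism is carried to a function on ω₁ and coded by its graph.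
    (record
      { to        = λ g → graphCode (E.to ∘ Automorphism.to g ∘ E.from)
      ; cong      = λ g≈h α → cong (λ k → graphCode k α) (ext λ β → cong E.to (g≈h (E.from β)))
      ; injective = λ {g} {h} eq x →
          subst (λ x → Automorphism.to g x ≡ Automorphism.to h x) (E.strictlyInverseʳ x)
            (Injection.injective (Inverse⇒Injection A↔ω₁) (graphCode-injective eq (E.to x)))
      })
    -- At least 2^ω₁: each bit sequence steers the plays to its own automorphism.
    (record
      { to        = automorphism
      ; cong      = λ eq x → cong (λ bits → Automorphism.to (automorphism bits) x) (ext eq)
      ; injective = automorphism-injective _ _
      })
  where
  module E = Inverse A↔ω₁
  open Ordinals em ext Ω
  open Branches em ext Ω A B A↔ω₁ B-large τ winning
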